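{- Let $\Delta=\Delta(X,Y,T,E)$ be an arbitrary tableau complex. Then: (1) $\Delta$ is pure, i.e. its facets (which are the tableaux $f\in T$) all have the same dimension; (2) the codimension of a face $F$ of $\Delta$ equals $\sum_{x\in X}(|F(x)|-1)$; in particular the faces of codimension $1$ (ridges) are the set-valued tableaux (faces) taking two values at exactly one $x\in X$ and one value at every other point of $X$; (3) each ridge is a face of at most two facets; in particular, if $\Delta$ is shellable then it is homeomorphic to a ball or a sphere; (4) the link of a face of $\Delta$ is again (isomorphic to) a tableau complex.
   Context: Let $X$ and $Y$ be finite sets. A tableau is a function $f:X\to Y$, identified with its graph $\{(x,f(x)):x\in X\}\subseteq X\times Y$. A set-valued tableau is a subset $F\subseteq X\times Y$; write $F(x)=\{y:(x,y)\in F\}$. For a tableau $f$, "$f\subseteq F$" means $f(x)\in F(x)$ for all $x$. Let $T$ be a set of tableaux and $E\subseteq X\times Y$ a subset containing (the graph of) every $f\in T$. For $(x,y)\in E$ put $v_{(x,y)}:=E\setminus\{(x,y)\}$. The tableau complex $\Delta(X,Y,T,E)$ is the simplicial complex on the ground set $\{v_{(x,y)}:(x,y)\in E\}$ whose faces are the sets $\{v_{(x,y)}:(x,y)\in E\setminus F\}$, where $F\subseteq E$ ranges over set-valued tableaux containing at least one $f\in T$; such a face is identified with $F$. Thus $F'$ is a face of $F$ iff $F'\supseteq F$, the facets are the tableaux $f\in T$, and $E$ is the empty face. The codimension of a face is the dimension of $\Delta$ minus the dimension of the face. The link of a face $C$ in a simplicial complex $\Delta$ is $\{D\in\Delta: D\cap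 C=\varnothing,\ D\cup C\in\Delta\}$. -}

module Defs where

open import Data.Nat using (ℕ; zero; suc; _*_)
open import Data.Integer as ℤ using (ℤ; +_; _-_; _≤_; 1ℤ; 0ℤ)
open import Data.Fin using (Fin; remQuot; _≟_) renaming (zero to fzero; suc to fsuc)
open import Data.Fin.Subset using (Subset; _∈_; _∉_; _⊆_; _∩_; _∪_; _─_; ∣_∣; ⁅_⁆; Empty)
open import Data.Vec using (Vec; lookup; tabulate)
open import Data.List using (List; allFin)
open import Data.Bool.ListAction using (any)
open import Data.List.Membership.Propositional using () renaming (_∈_ to _∈ₗ_)
open import Data.Bool using (Bool; _∧_)
open import Data.Product using (Σ; _×_; _,_; ∃; ∃-syntax)
open import Relation.Nullary using (¬_)
open import Relation.Nullary.Decidable using (⌊_⌋)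
open import Relation.Binary.PropositionalEquality using (_≡_)
open import Function.Bundles using (_⇔_)

Complex : ℕ → Set₁
Complex k = Subset k → Set

module _ {k : ℕ} (Δ : Complex k) where

  Facet : Subset k → Set
  Facet σ = Δ σ × (∀ τ → Δ τ → σ ⊆ τ → τ ⊆ σ)

  Pure : Set
  Pure = ∀ σ τ → Facet σ → Facet τ → ∣ σ ∣ ≡ ∣ τ ∣

dim : ∀ {k} → Subset k → ℤ
dim σ = + ∣ σ ∣ - 1ℤ

module _ {k : ℕ} (Δ : Complex k) where

  IsDim : ℤ → Set
  IsDim d = (∃[ σ ] (Δ σ × dim σ ≡ d)) × (∀ σ → Δ σ → dim σ ≤ d)

  codim : ℤ → Subset k → ℤ
  codim d σ = d - dim σ

  Link : Subset k → Complex k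
  Link C D = Empty (D ∩ C) × Δ (D ∪ C)

  Vertex : Fin k → Set
  Vertex v = Δ ⁅ v ⁆

image : ∀ {k l} → (Fin k → Fin l) → Subset k → Subset l
image {k} φ σ = tabulate (λ w → any (λ v → lookup σ v ∧ ⌊ φ v ≟ w ⌋) (allFin k))

record _≅_ {k l : ℕ} (Δ₁ : Complex k) (Δ₂ : Complex l) : Set where
  field
    φ : Fin k → Fin l
    ψ : Fin l → Fin k
    φ-vert : ∀ v → Vertex Δ₁ v → Vertex Δ₂ (φ v)
    ψ-vert : ∀ w → Vertex Δ₂ w → Vertex Δ₁ (ψ w)
    ψφ : ∀ v → Vertex Δ₁ v → ψ (φ v) ≡ v
    φψ : ∀ w → Vertex Δ₂ w → φ (ψ w) ≡ w
    φ-face : ∀ σ → Δ₁ σ → Δ₂ (image φ σ)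
    ψ-face : ∀ τ → Δ₂ τ → Δ₁ (image ψ τ)

-- Tableaux with X = Fin n, Y = Fin m.

Tableau : ℕ → ℕ → Set
Tableau n m = Fin n → Fin m

-- set-valued tableau F ⊆ X × Y, given by F(x) ⊆ Y for each x
SetTableau : ℕ → ℕ → Set
SetTableau n m = Fin n → Subset m

_⊆ₜ_ : ∀ {n m} → Tableau n m → SetTableau n m → Set
f ⊆ₜ F = ∀ x → f x ∈ F x

_⊆ₛ_ : ∀ {n m} → SetTableau n m → SetTableau n m → Set
F ⊆ₛ G = ∀ x → F x ⊆ G x

_∖ₛ_ : ∀ {n m} → SetTableau n m → SetTableau n m → SetTableau n m
(G ∖ₛ F) x = G x ─ F x

-- the pair (x , y) ∈ X × Y is encoded as the element combine x y of Fin (n * m);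
-- encode S is the subset {(x , y) : y ∈ S(x)} of the ground set Fin (n * m)
encode : ∀ {n m} → SetTableau n m → Subset (n * m)
encode {n} {m} S = tabulate (λ i → let (x , y) = remQuot {n} m i in lookup (S x) y)

IsTFace : ∀ {n m} → List (Tableau n m) → SetTableau n m → SetTableau n m → Set
IsTFace T E F = F ⊆ₛ E × (∃[ f ] (f ∈ₗ T × f ⊆ₜ F))

-- The tableau complex Δ(X,Y,T,E) on the ground set {v_(x,y)} ⊆ Fin (n * m)
-- (v_(x,y) encoded as combine x y): its faces are the sets
-- {v_(x,y) : (x,y) ∈ E \ F} for F a face as above.
TableauComplex : (n m : ℕ) → List (Tableau n m) → SetTableau n m → Complex (n * m)
TableauComplex n m T E σ = ∃[ F ] (IsTFace T E F × σ ≡ encode (E ∖ₛ F))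

faceOf : ∀ {n m} → SetTableau n m → SetTableau n m → Subset (n * m)
faceOf E F = encode (E ∖ₛ F)

Admissible : ∀ {n m} → List (Tableau n m) → SetTableau n m → Set
Admissible T E = ∀ f → f ∈ₗ T → f ⊆ₜ E

sumℤ : ∀ {n} → (Fin n → ℤ) → ℤ
sumℤ {zero} g = 0ℤ
sumℤ {suc n} g = g fzero ℤ.+ sumℤ (λ i → g (fsuc i))

{-# OPTIONS --safe #-}
-- A face F ⊆ E of Δ is the vertex set E ∖ F, so it has ∣E∣ − Σₓ ∣F x∣ vertices. Every face
-- contains the graph of some f ∈ T, itself a face; hence the facets are exactly these graphs,
-- all with ∣E∣ − ∣X∣ vertices, and the codimension of F is its excess Σₓ (∣F x∣ − 1). In a
-- ridge F x₀ has two elements and every other F x one, so a tableau inside F is determined by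
-- its value at x₀ and at most two facets contain the ridge. Finally the faces of the link of
-- E ∖ F are the sets F ∖ G for G a face of Δ(X, Y, T_F, F), T_F being the tableaux inside F,
-- so the identity on vertices is an isomorphism onto that tableau complex.

module Submission where

open import Defs
import Data.Nat.Properties as ℕₚ
open import Algebra.Properties.CommutativeMonoid.Sum ℕₚ.+-0-commutativeMonoid
  using (sum-syntax; sum-cong-≗; sum-replicate-zero)
open import Data.Bool using (Bool; _∧_)
open import Data.Bool.Properties using (T-≡; T-∧)
open import Data.Fin using (Fin; _≟_; combine; remQuot) renaming (zero to fzero; suc to fsuc)
open import Data.Fin.Properties using (all?; remQuot-combine; combine-remQuot; suc-injective)
open import Data.Fin.Subset
  using (Subset; inside; outside; _∈_; _∉_; _⊆_; _∩_; _∪_; _─_; ∣_∣; ⁅_⁆; Empty)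
open import Data.Fin.Subset.Properties
  using (_∈?_; ⊆-antisym; drop-∷-⊆; x∈⁅x⁆; x∈⁅y⁆⇒x≡y; ∣⁅x⁆∣≡1; x∈p∩q⁺; x∈p∩q⁻; x∈p∪q⁺; x∈p∪q⁻;
         x∈p∧x∉q⇒x∈p─q; p─q⊆p; x∈p∧x≢y⇒x∈p-y; x∈p⇒∣p-x∣<∣p∣)
open import Data.Integer as ℤ using (ℤ; +_; _-_; 1ℤ; +≤+)
open import Data.Integer.Properties as ℤₚ using (pos-+; ⊖-≥; +-injective)
open import Data.Integer.Tactic.RingSolver using (solve-∀)
open import Data.List using (List; allFin; filter)
open import Data.List.Membership.Propositional using (lose) renaming (_∈_ to _∈ₗ_)
open import Data.List.Membership.Propositional.Properties using (∈-allFin; ∈-filter⁺; ∈-filter⁻)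
open import Data.List.Relation.Unary.Any using (satisfied)
open import Data.List.Relation.Unary.Any.Properties using (any⁺; any⁻)
open import Data.Nat using (ℕ; zero; suc; _+_; _*_; _∸_; _≤_; _<_; s≤s; z≤n)
open import Data.Nat.Properties
  using (+-suc; +-assoc; +-identityʳ; +-cancelʳ-≡; m≤m+n; ≤-trans; ≤-reflexive; ≤-pred; m+n≡0⇒m≡0; m+n≡0⇒n≡0)
  renaming (suc-injective to ℕ-suc-injective)
open import Data.Product using (Σ; _×_; _,_; proj₁; proj₂; ∃-syntax)
open import Data.Sum as Sum using (_⊎_; inj₁; inj₂)
open import Data.Vec using ([]; _∷_; _++_; concat; lookup; tabulate; here; there)
open import Data.Vec.Properties using (lookup∘tabulate; tabulate-cong; lookup-concat; []=⇒lookup; lookup⇒[]=)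
open import Data.Vec.Relation.Binary.Pointwise.Extensional using (ext; Pointwise-≡⇒≡)
open import Function using (_∘_; id; _⇔_; mk⇔; Equivalence)
open import Relation.Nullary using (¬_; Dec; yes; no; contradiction)
open import Relation.Nullary.Decidable using (⌊_⌋; toWitness; fromWitness)
open import Relation.Binary.PropositionalEquality
  using (_≡_; _≢_; _≗_; refl; sym; trans; cong; cong₂; subst; subst₂; module ≡-Reasoning)

open Equivalence using (to; from)

private
  variable
    k n m : ℕ
    x y z : Fin k
    p q r : Subset k
    f g h : Tableau n m

x∈p─q⇒x∉q : x ∈ p ─ q → x ∉ q
x∈p─q⇒x∉q {p = _ ∷ _} {q = outside ∷ _} here       ()
x∈p─q⇒x∉q {p = _ ∷ _} {q = _ ∷ _}       (there x∈) (there x∈q) = x∈p─q⇒x∉q x∈ x∈q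

x∈p⇒0<∣p∣ : x ∈ p → 0 < ∣ p ∣
x∈p⇒0<∣p∣ x∈p = ≤-trans (s≤s z≤n) (x∈p⇒∣p-x∣<∣p∣ x∈p)

∣p─q∣+∣q∣≡∣p∣ : ∀ (p q : Subset k) → q ⊆ p → ∣ p ─ q ∣ + ∣ q ∣ ≡ ∣ p ∣
∣p─q∣+∣q∣≡∣p∣ []            []            _   = refl
∣p─q∣+∣q∣≡∣p∣ (inside  ∷ p) (inside  ∷ q) q⊆p = trans (+-suc _ _) (cong suc (∣p─q∣+∣q∣≡∣p∣ p q (drop-∷-⊆ q⊆p)))
∣p─q∣+∣q∣≡∣p∣ (inside  ∷ p) (outside ∷ q) q⊆p = cong suc (∣p─q∣+∣q∣≡∣p∣ p q (drop-∷-⊆ q⊆p))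
∣p─q∣+∣q∣≡∣p∣ (outside ∷ p) (outside ∷ q) q⊆p = ∣p─q∣+∣q∣≡∣p∣ p q (drop-∷-⊆ q⊆p)
∣p─q∣+∣q∣≡∣p∣ (outside ∷ p) (inside  ∷ q) q⊆p = contradiction (q⊆p here) λ ()

∣p++q∣≡∣p∣+∣q∣ : ∀ (p : Subset k) (q : Subset n) → ∣ p ++ q ∣ ≡ ∣ p ∣ + ∣ q ∣
∣p++q∣≡∣p∣+∣q∣ []            q = refl
∣p++q∣≡∣p∣+∣q∣ (inside  ∷ p) q = cong suc (∣p++q∣≡∣p∣+∣q∣ p q)
∣p++q∣≡∣p∣+∣q∣ (outside ∷ p) q = ∣p++q∣≡∣p∣+∣q∣ p q

q⊆r⇒p─r⊆p─q : q ⊆ r → p ─ r ⊆ p ─ q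
q⊆r⇒p─r⊆p─q q⊆r x∈p─r =
  x∈p∧x∉q⇒x∈p─q (p─q⊆p _ _ x∈p─r) (x∈p─q⇒x∉q x∈p─r ∘ q⊆r)

p─q⊆p─r⇒r⊆q : r ⊆ p → p ─ q ⊆ p ─ r → r ⊆ q
p─q⊆p─r⇒r⊆q {q = q} r⊆p p─q⊆p─r {x} x∈r with x ∈? q
... | yes x∈q = x∈q
... | no  x∉q = contradiction x∈r (x∈p─q⇒x∉q (p─q⊆p─r (x∈p∧x∉q⇒x∈p─q (r⊆p x∈r) x∉q)))

∣p∣≤1⇒x≡y : ∣ p ∣ ≤ 1 → x ∈ p → y ∈ p → x ≡ y
∣p∣≤1⇒x≡y {p = p} {x = x} {y = y} ∣p∣≤1 x∈p y∈p with x ≟ y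
... | yes x≡y = x≡y
... | no  x≢y = contradiction (≤-trans 2≤∣p∣ ∣p∣≤1) λ { (s≤s ()) }
  where
  2≤∣p∣ : 2 ≤ ∣ p ∣
  2≤∣p∣ = ≤-trans (s≤s (x∈p⇒0<∣p∣ (x∈p∧x≢y⇒x∈p-y y∈p (x≢y ∘ sym)))) (x∈p⇒∣p-x∣<∣p∣ x∈p)

∣p∣≤2⇒x≡y⊎x≡z⊎y≡z : ∣ p ∣ ≤ 2 → x ∈ p → y ∈ p → z ∈ p → x ≡ y ⊎ x ≡ z ⊎ y ≡ z
∣p∣≤2⇒x≡y⊎x≡z⊎y≡z {p = p} {x = x} {y = y} {z = z} ∣p∣≤2 x∈p y∈p z∈p with x ≟ y | x ≟ z
... | yes x≡y | _        = inj₁ x≡y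
... | no  _   | yes x≡z = inj₂ (inj₁ x≡z)
... | no  x≢y | no  x≢z = inj₂ (inj₂ (∣p∣≤1⇒x≡y ∣p-x∣≤1 (x∈p∧x≢y⇒x∈p-y y∈p (x≢y ∘ sym)) (x∈p∧x≢y⇒x∈p-y z∈p (x≢z ∘ sym))))
  where
  ∣p-x∣≤1 : ∣ p ─ ⁅ x ⁆ ∣ ≤ 1
  ∣p-x∣≤1 = ≤-pred (≤-trans (x∈p⇒∣p-x∣<∣p∣ x∈p) ∣p∣≤2)

module _ {p q r s : Subset k} (q⊆p : q ⊆ p) where

  s∪[p─q]≡p─r⇒s≡q─r : r ⊆ p → Empty (s ∩ (p ─ q)) → s ∪ (p ─ q) ≡ p ─ r → r ⊆ q × s ≡ q ─ r
  s∪[p─q]≡p─r⇒s≡q─r r⊆p s∩[p─q]≡∅ s∪[p─q]≡p─r = r⊆q , ⊆-antisym s⊆q─r q─r⊆s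
    where
    ⊆p─r : ∀ {x} → x ∈ s ⊎ x ∈ p ─ q → x ∈ p ─ r
    ⊆p─r = subst (_ ∈_) s∪[p─q]≡p─r ∘ x∈p∪q⁺
    r⊆q : r ⊆ q
    r⊆q = p─q⊆p─r⇒r⊆q r⊆p (⊆p─r ∘ inj₂)
    s⊆q─r : s ⊆ q ─ r
    s⊆q─r {x} x∈s with x ∈? q
    ... | yes x∈q = x∈p∧x∉q⇒x∈p─q x∈q (x∈p─q⇒x∉q (⊆p─r (inj₁ x∈s)))
    ... | no  x∉q = contradiction (x , x∈p∩q⁺ (x∈s , x∈p∧x∉q⇒x∈p─q (p─q⊆p _ _ (⊆p─r (inj₁ x∈s))) x∉q)) s∩[p─q]≡∅
    q─r⊆s : q ─ r ⊆ s
    q─r⊆s x∈q─r with x∈p∪q⁻ s (p ─ q) (subst (_ ∈_) (sym s∪[p─q]≡p─r)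
                       (x∈p∧x∉q⇒x∈p─q (q⊆p (p─q⊆p _ _ x∈q─r)) (x∈p─q⇒x∉q x∈q─r)))
    ... | inj₁ x∈s   = x∈s
    ... | inj₂ x∈p─q = contradiction (p─q⊆p _ _ x∈q─r) (x∈p─q⇒x∉q x∈p─q)

  s≡q─r⇒s∪[p─q]≡p─r : r ⊆ q → s ≡ q ─ r → Empty (s ∩ (p ─ q)) × s ∪ (p ─ q) ≡ p ─ r
  s≡q─r⇒s∪[p─q]≡p─r r⊆q refl = s∩[p─q]≡∅ , ⊆-antisym ⊆p─r p─r⊆
    where
    s∩[p─q]≡∅ : Empty ((q ─ r) ∩ (p ─ q))
    s∩[p─q]≡∅ (x , x∈) with x∈p∩q⁻ (q ─ r) (p ─ q) x∈
    ... | x∈q─r , x∈p─q = x∈p─q⇒x∉q x∈p─q (p─q⊆p _ _ x∈q─r)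
    ⊆p─r : (q ─ r) ∪ (p ─ q) ⊆ p ─ r
    ⊆p─r x∈ with x∈p∪q⁻ (q ─ r) (p ─ q) x∈
    ... | inj₁ x∈q─r = x∈p∧x∉q⇒x∈p─q (q⊆p (p─q⊆p _ _ x∈q─r)) (x∈p─q⇒x∉q x∈q─r)
    ... | inj₂ x∈p─q = x∈p∧x∉q⇒x∈p─q (p─q⊆p _ _ x∈p─q) (x∈p─q⇒x∉q x∈p─q ∘ r⊆q)
    p─r⊆ : p ─ r ⊆ (q ─ r) ∪ (p ─ q)
    p─r⊆ {x} x∈p─r with x ∈? q
    ... | yes x∈q = x∈p∪q⁺ (inj₁ (x∈p∧x∉q⇒x∈p─q x∈q (x∈p─q⇒x∉q x∈p─r)))
    ... | no  x∉q = x∈p∪q⁺ (inj₂ (x∈p∧x∉q⇒x∈p─q (p─q⊆p _ _ x∈p─r) x∉q))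

image-id : ∀ (σ : Subset k) → image id σ ≡ σ
image-id {k} σ = ⊆-antisym image⊆σ σ⊆image
  where
  P : Fin k → Fin k → Bool
  P w v = lookup σ v ∧ ⌊ v ≟ w ⌋
  image⊆σ : image id σ ⊆ σ
  image⊆σ {w} w∈ with satisfied (any⁻ (P w) (allFin k) (from T-≡ (trans (sym (lookup∘tabulate _ w)) ([]=⇒lookup w∈))))
  ... | v , Pwv with to T-∧ Pwv
  ... | σv , v≡w = subst (_∈ σ) (toWitness v≡w) (lookup⇒[]= v σ (to T-≡ σv))
  σ⊆image : σ ⊆ image id σ
  σ⊆image {w} w∈σ = lookup⇒[]= w _ (trans (lookup∘tabulate _ w)
    (to T-≡ (any⁺ (P w) (lose (∈-allFin w) (from T-∧ (from T-≡ ([]=⇒lookup w∈σ) , fromWitness refl))))))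

⇔⇒≅ : ∀ {Δ₁ Δ₂ : Complex k} → (∀ σ → Δ₁ σ ⇔ Δ₂ σ) → Δ₁ ≅ Δ₂
⇔⇒≅ {Δ₁ = Δ₁} {Δ₂} Δ₁⇔Δ₂ = record
  { φ      = id
  ; ψ      = id
  ; φ-vert = λ v → to (Δ₁⇔Δ₂ ⁅ v ⁆)
  ; ψ-vert = λ w → from (Δ₁⇔Δ₂ ⁅ w ⁆)
  ; ψφ     = λ _ _ → refl
  ; φψ     = λ _ _ → refl
  ; φ-face = λ σ → subst Δ₂ (sym (image-id σ)) ∘ to (Δ₁⇔Δ₂ σ)
  ; ψ-face = λ τ → subst Δ₁ (sym (image-id τ)) ∘ from (Δ₁⇔Δ₂ τ)
  }

≡0⇒∑≡0 : ∀ (b : Fin n → ℕ) → (∀ x → b x ≡ 0) → ∑[ x < n ] b x ≡ 0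
≡0⇒∑≡0 {n} b b≡0 = trans (sum-cong-≗ b≡0) (sum-replicate-zero n)

∑≡0⇒≡0 : ∀ (b : Fin n → ℕ) → ∑[ x < n ] b x ≡ 0 → ∀ x → b x ≡ 0
∑≡0⇒≡0 b ∑≡0 fzero    = m+n≡0⇒m≡0 (b fzero) ∑≡0
∑≡0⇒≡0 b ∑≡0 (fsuc x) = ∑≡0⇒≡0 (b ∘ fsuc) (m+n≡0⇒n≡0 (b fzero) ∑≡0) x

∑≡1⇒one-term-1 : ∀ (b : Fin n → ℕ) → ∑[ x < n ] b x ≡ 1 → ∃[ x₀ ] (b x₀ ≡ 1 × ∀ x → x ≢ x₀ → b x ≡ 0)
∑≡1⇒one-term-1 {suc n} b ∑≡1 with b fzero in b₀≡
... | 0 with ∑≡1⇒one-term-1 (b ∘ fsuc) ∑≡1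
...   | x₀ , b≡1 , b≡0 = fsuc x₀ , b≡1 , λ
        { fzero    _  → b₀≡
        ; (fsuc x) x≢ → b≡0 x (x≢ ∘ cong fsuc) }
∑≡1⇒one-term-1 {suc n} b ∑≡1 | 1 = fzero , b₀≡ , λ
        { fzero    x≢ → contradiction refl x≢
        ; (fsuc x) _  → ∑≡0⇒≡0 (b ∘ fsuc) (ℕ-suc-injective ∑≡1) x }

one-term-1⇒∑≡1 : ∀ (b : Fin n → ℕ) → ∃[ x₀ ] (b x₀ ≡ 1 × ∀ x → x ≢ x₀ → b x ≡ 0) → ∑[ x < n ] b x ≡ 1
one-term-1⇒∑≡1 b (fzero , b₀≡1 , b≡0) =
  cong₂ _+_ b₀≡1 (≡0⇒∑≡0 (b ∘ fsuc) λ x → b≡0 (fsuc x) λ ())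
one-term-1⇒∑≡1 b (fsuc x₀ , b≡1 , b≡0) =
  cong₂ _+_ (b≡0 fzero λ ()) (one-term-1⇒∑≡1 (b ∘ fsuc) (x₀ , b≡1 , λ x x≢ → b≡0 (fsuc x) (x≢ ∘ suc-injective)))

∑≡∑∸1+n : ∀ (a : Fin n → ℕ) → (∀ x → 0 < a x) → ∑[ x < n ] a x ≡ ∑[ x < n ] (a x ∸ 1) + n
∑≡∑∸1+n {zero}  a _ = refl
∑≡∑∸1+n {suc n} a 0<a with a fzero | 0<a fzero
... | suc a₀ | _ = trans (cong suc (trans (cong (λ t → a₀ + t) (∑≡∑∸1+n (a ∘ fsuc) (0<a ∘ fsuc)))
                                         (sym (+-assoc a₀ _ n))))
                         (sym (+-suc _ n))

sumℤ[+a-1]≡+∑[a∸1] : ∀ (a : Fin n → ℕ) → (∀ x → 0 < a x) →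
                     sumℤ (λ x → + a x - 1ℤ) ≡ + ∑[ x < n ] (a x ∸ 1)
sumℤ[+a-1]≡+∑[a∸1] {zero}  a _   = refl
sumℤ[+a-1]≡+∑[a∸1] {suc n} a 0<a =
  trans (cong₂ ℤ._+_ (⊖-≥ (0<a fzero)) (sumℤ[+a-1]≡+∑[a∸1] (a ∘ fsuc) (0<a ∘ fsuc)))
        (sym (pos-+ (a fzero ∸ 1) _))

module _ {n m : ℕ} where

  ∈-encode : ∀ (S : SetTableau n m) i → i ∈ encode S ⇔ proj₂ (remQuot {n} m i) ∈ S (proj₁ (remQuot {n} m i))
  ∈-encode S i = mk⇔
    (λ i∈ → lookup⇒[]= _ _ (trans (sym (lookup∘tabulate _ i)) ([]=⇒lookup i∈)))
    (λ y∈ → lookup⇒[]= _ _ (trans (lookup∘tabulate _ i) ([]=⇒lookup y∈)))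

  combine∈encode⇔ : ∀ (S : SetTableau n m) x y → combine x y ∈ encode S ⇔ y ∈ S x
  combine∈encode⇔ S x y = mk⇔
    (λ xy∈ → subst (λ (x , y) → y ∈ S x) (remQuot-combine x y) (to (∈-encode S (combine x y)) xy∈))
    (λ y∈ → from (∈-encode S (combine x y)) (subst (λ (x , y) → y ∈ S x) (sym (remQuot-combine x y)) y∈))

  encode-mono : ∀ {S S′ : SetTableau n m} → S ⊆ₛ S′ → encode S ⊆ encode S′
  encode-mono {S} {S′} S⊆S′ {i} i∈ = from (∈-encode S′ i) (S⊆S′ _ (to (∈-encode S i) i∈))

  encode-reflects-⊆ : ∀ {S S′ : SetTableau n m} → encode S ⊆ encode S′ → S ⊆ₛ S′
  encode-reflects-⊆ {S} {S′} encS⊆encS′ x y∈ =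
    to (combine∈encode⇔ S′ x _) (encS⊆encS′ (from (combine∈encode⇔ S x _) y∈))

  encode-cong : ∀ {S S′ : SetTableau n m} → (∀ x → S x ≡ S′ x) → encode S ≡ encode S′
  encode-cong S≗S′ = tabulate-cong λ i → cong (λ p → lookup p _) (S≗S′ _)

  encode-∖ₛ : ∀ (S S′ : SetTableau n m) → encode (S ∖ₛ S′) ≡ encode S ─ encode S′
  encode-∖ₛ S S′ = ⊆-antisym ⊆─ ─⊆
    where
    ⊆─ : encode (S ∖ₛ S′) ⊆ encode S ─ encode S′
    ⊆─ {i} i∈ = let y∈ = to (∈-encode (S ∖ₛ S′) i) i∈ in
      x∈p∧x∉q⇒x∈p─q (from (∈-encode S i) (p─q⊆p _ _ y∈)) (x∈p─q⇒x∉q y∈ ∘ to (∈-encode S′ i))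
    ─⊆ : encode S ─ encode S′ ⊆ encode (S ∖ₛ S′)
    ─⊆ {i} i∈ = from (∈-encode (S ∖ₛ S′) i) (x∈p∧x∉q⇒x∈p─q
      (to (∈-encode S i) (p─q⊆p _ _ i∈)) (x∈p─q⇒x∉q i∈ ∘ from (∈-encode S′ i)))

  encode≡concat : ∀ (S : SetTableau n m) → encode S ≡ concat (tabulate S)
  encode≡concat S = Pointwise-≡⇒≡ (ext lookup≡)
    where
    open ≡-Reasoning
    lookup≡ : ∀ i → lookup (encode S) i ≡ lookup (concat (tabulate S)) i
    lookup≡ i = let (x , y) = remQuot m i in begin
      lookup (encode S) i                         ≡⟨ lookup∘tabulate _ i ⟩
      lookup (S x) y                              ≡⟨ cong (λ p → lookup p y) (lookup∘tabulate S x) ⟨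
      lookup (lookup (tabulate S) x) y            ≡⟨ lookup-concat (tabulate S) x y ⟨
      lookup (concat (tabulate S)) (combine x y)  ≡⟨ cong (lookup (concat (tabulate S))) (combine-remQuot {n} m i) ⟩
      lookup (concat (tabulate S)) i              ∎

∣concat∘tabulate∣ : ∀ (S : SetTableau n m) → ∣ concat (tabulate S) ∣ ≡ ∑[ x < n ] ∣ S x ∣
∣concat∘tabulate∣ {zero}  S = refl
∣concat∘tabulate∣ {suc n} S =
  trans (∣p++q∣≡∣p∣+∣q∣ (S fzero) _) (cong (λ t → ∣ S fzero ∣ + t) (∣concat∘tabulate∣ (S ∘ fsuc)))

∣encode∣ : ∀ (S : SetTableau n m) → ∣ encode S ∣ ≡ ∑[ x < n ] ∣ S x ∣
∣encode∣ S = trans (cong ∣_∣ (encode≡concat S)) (∣concat∘tabulate∣ S)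

graph : Tableau n m → SetTableau n m
graph f x = ⁅ f x ⁆

excess : SetTableau n m → ℕ
excess {n} F = ∑[ x < n ] (∣ F x ∣ ∸ 1)

_⊆ₜ?_ : ∀ (f : Tableau n m) (F : SetTableau n m) → Dec (f ⊆ₜ F)
f ⊆ₜ? F = all? λ x → f x ∈? F x

module _ {f : Tableau n m} {F : SetTableau n m} where

  ⊆ₜ⇒graph⊆ₛ : f ⊆ₜ F → graph f ⊆ₛ F
  ⊆ₜ⇒graph⊆ₛ f⊆F x y∈ = subst (_∈ F x) (sym (x∈⁅y⁆⇒x≡y (f x) y∈)) (f⊆F x)

  ⊆ₜ⇒0<∣F∣ : f ⊆ₜ F → ∀ x → 0 < ∣ F x ∣
  ⊆ₜ⇒0<∣F∣ f⊆F x = x∈p⇒0<∣p∣ (f⊆F x)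

  ∣encode∣≡excess+n : f ⊆ₜ F → ∣ encode F ∣ ≡ excess F + n
  ∣encode∣≡excess+n f⊆F = trans (∣encode∣ F) (∑≡∑∸1+n _ (⊆ₜ⇒0<∣F∣ f⊆F))

  excess≡1⇔ : f ⊆ₜ F → excess F ≡ 1 ⇔ (∃[ x₀ ] (∣ F x₀ ∣ ≡ 2 × ∀ x → x ≢ x₀ → ∣ F x ∣ ≡ 1))
  excess≡1⇔ f⊆F = mk⇔
    (λ excess≡1 → let (x₀ , ≡1 , ≡0) = ∑≡1⇒one-term-1 _ excess≡1 in
       x₀ , to (∸1≡⇔ x₀) ≡1 , λ x x≢ → to (∸1≡⇔ x) (≡0 x x≢))
    (λ (x₀ , ≡2 , ≡1) → one-term-1⇒∑≡1 _ (x₀ , from (∸1≡⇔ x₀) ≡2 , λ x x≢ → from (∸1≡⇔ x) (≡1 x x≢)))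
    where
    ∸1≡⇔ : ∀ x {k} → ∣ F x ∣ ∸ 1 ≡ k ⇔ ∣ F x ∣ ≡ suc k
    ∸1≡⇔ x with ∣ F x ∣ | ⊆ₜ⇒0<∣F∣ f⊆F x
    ... | suc _ | _ = mk⇔ (cong suc) ℕ-suc-injective

excess-graph : ∀ (f : Tableau n m) → excess (graph f) ≡ 0
excess-graph f = ≡0⇒∑≡0 _ λ x → cong (_∸ 1) (∣⁅x⁆∣≡1 (f x))

faceOf-graph-cong : ∀ (E : SetTableau n m) {f g : Tableau n m} → f ≗ g → faceOf E (graph f) ≡ faceOf E (graph g)
faceOf-graph-cong E f≗g = encode-cong λ x → cong (λ y → E x ─ ⁅ y ⁆) (f≗g x)

module _ (E : SetTableau n m) {F : SetTableau n m} where

  faceOf≡─ : faceOf E F ≡ encode E ─ encode F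
  faceOf≡─ = encode-∖ₛ E F

  ∣faceOf∣+∣encode∣≡∣encode∣ : F ⊆ₛ E → ∣ faceOf E F ∣ + ∣ encode F ∣ ≡ ∣ encode E ∣
  ∣faceOf∣+∣encode∣≡∣encode∣ F⊆E =
    trans (cong (λ σ → ∣ σ ∣ + ∣ encode F ∣) faceOf≡─) (∣p─q∣+∣q∣≡∣p∣ _ _ (encode-mono {S = F} {S′ = E} F⊆E))

  faceOf-antitone : ∀ {G} → G ⊆ₛ F → faceOf E F ⊆ faceOf E G
  faceOf-antitone {G} G⊆F = subst₂ _⊆_ (sym faceOf≡─) (sym (encode-∖ₛ E G)) (q⊆r⇒p─r⊆p─q (encode-mono {S = G} {S′ = F} G⊆F))

  faceOf-reflects-⊆ : ∀ {G} → G ⊆ₛ E → faceOf E F ⊆ faceOf E G → G ⊆ₛ F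
  faceOf-reflects-⊆ {G} G⊆E face⊆face = encode-reflects-⊆ {S = G} {S′ = F} (p─q⊆p─r⇒r⊆q (encode-mono {S = G} {S′ = E} G⊆E)
    (subst₂ _⊆_ faceOf≡─ (encode-∖ₛ E G) face⊆face))

module _ {F : SetTableau n m} {x₀ : Fin n} (∣F∣≤1 : ∀ x → x ≢ x₀ → ∣ F x ∣ ≤ 1) where

  ⊆ₜ-agree : f ⊆ₜ F → g ⊆ₜ F → f x₀ ≡ g x₀ → f ≗ g
  ⊆ₜ-agree f⊆F g⊆F fx₀≡gx₀ x with x ≟ x₀
  ... | yes refl = fx₀≡gx₀
  ... | no  x≢x₀ = ∣p∣≤1⇒x≡y (∣F∣≤1 x x≢x₀) (f⊆F x) (g⊆F x)

  ⊆ₜ-pigeonhole : ∣ F x₀ ∣ ≤ 2 → f ⊆ₜ F → g ⊆ₜ F → h ⊆ₜ F → f ≗ g ⊎ f ≗ h ⊎ g ≗ h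
  ⊆ₜ-pigeonhole ∣Fx₀∣≤2 f⊆F g⊆F h⊆F =
    Sum.map (⊆ₜ-agree f⊆F g⊆F) (Sum.map (⊆ₜ-agree f⊆F h⊆F) (⊆ₜ-agree g⊆F h⊆F))
      (∣p∣≤2⇒x≡y⊎x≡z⊎y≡z ∣Fx₀∣≤2 (f⊆F x₀) (g⊆F x₀) (h⊆F x₀))

[x+y-1]-[x-1]≡y : ∀ (x y : ℤ) → ((x ℤ.+ y) - 1ℤ) - (x - 1ℤ) ≡ y
[x+y-1]-[x-1]≡y = solve-∀

module _ (T : List (Tableau n m)) (E : SetTableau n m) (admissible : Admissible T E) where

  private
    Δ : Complex (n * m)
    Δ = TableauComplex n m T E

  graph-isTFace : ∀ {f} → f ∈ₗ T → IsTFace T E (graph f)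
  graph-isTFace {f} f∈T = ⊆ₜ⇒graph⊆ₛ (admissible f f∈T) , f , f∈T , λ x → x∈⁅x⁆ (f x)

  graph-face : ∀ {f} → f ∈ₗ T → Δ (faceOf E (graph f))
  graph-face f∈T = _ , graph-isTFace f∈T , refl

  ∣face∣+excess≡∣facet∣ : ∀ {F f} → IsTFace T E F → f ∈ₗ T → ∣ faceOf E F ∣ + excess F ≡ ∣ faceOf E (graph f) ∣
  ∣face∣+excess≡∣facet∣ {F} {f} (F⊆E , g , _ , g⊆F) f∈T = +-cancelʳ-≡ n _ _ (begin
    ∣ faceOf E F ∣ + excess F + n                  ≡⟨ +-assoc ∣ faceOf E F ∣ (excess F) n ⟩
    ∣ faceOf E F ∣ + (excess F + n)                ≡⟨ cong (λ t → ∣ faceOf E F ∣ + t) (∣encode∣≡excess+n g⊆F) ⟨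
    ∣ faceOf E F ∣ + ∣ encode F ∣                  ≡⟨ ∣faceOf∣+∣encode∣≡∣encode∣ E F⊆E ⟩
    ∣ encode E ∣                                   ≡⟨ ∣faceOf∣+∣encode∣≡∣encode∣ E graph⊆E ⟨
    ∣ faceOf E (graph f) ∣ + ∣ encode (graph f) ∣  ≡⟨ cong (λ t → ∣ faceOf E (graph f) ∣ + t) ∣encode-graph∣ ⟩
    ∣ faceOf E (graph f) ∣ + n                     ∎)
    where
    open ≡-Reasoning
    graph⊆E : graph f ⊆ₛ E
    graph⊆E = proj₁ (graph-isTFace f∈T)
    ∣encode-graph∣ : ∣ encode (graph f) ∣ ≡ n
    ∣encode-graph∣ = trans (∣encode∣≡excess+n (λ x → x∈⁅x⁆ (f x))) (cong (_+ n) (excess-graph f))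

  facet⇒faceOf-graph : ∀ {σ} → Facet Δ σ → ∃[ f ] (f ∈ₗ T × σ ≡ faceOf E (graph f))
  facet⇒faceOf-graph {σ} ((F , (_ , f , f∈T , f⊆F) , σ≡) , maximal) =
    f , f∈T , ⊆-antisym σ⊆facet (maximal _ (graph-face f∈T) σ⊆facet)
    where
    σ⊆facet : σ ⊆ faceOf E (graph f)
    σ⊆facet = subst (_⊆ faceOf E (graph f)) (sym σ≡) (faceOf-antitone E (⊆ₜ⇒graph⊆ₛ f⊆F))

  ∣faceOf-graph∣≡∣faceOf-graph∣ : ∀ {f g} → f ∈ₗ T → g ∈ₗ T → ∣ faceOf E (graph f) ∣ ≡ ∣ faceOf E (graph g) ∣
  ∣faceOf-graph∣≡∣faceOf-graph∣ {f} {g} f∈T g∈T = begin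
    ∣ faceOf E (graph f) ∣                      ≡⟨ +-identityʳ _ ⟨
    ∣ faceOf E (graph f) ∣ + 0                  ≡⟨ cong (λ e → ∣ faceOf E (graph f) ∣ + e) (excess-graph f) ⟨
    ∣ faceOf E (graph f) ∣ + excess (graph f)   ≡⟨ ∣face∣+excess≡∣facet∣ (graph-isTFace f∈T) g∈T ⟩
    ∣ faceOf E (graph g) ∣                      ∎
    where open ≡-Reasoning

  pure : Pure Δ
  pure σ τ σ-facet τ-facet with facet⇒faceOf-graph σ-facet | facet⇒faceOf-graph τ-facet
  ... | f , f∈T , refl | g , g∈T , refl = ∣faceOf-graph∣≡∣faceOf-graph∣ f∈T g∈T

  dim≡∣face∣+excess-1 : ∀ {d F} → IsDim Δ d → IsTFace T E F → d ≡ + (∣ faceOf E F ∣ + excess F) - 1ℤ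
  dim≡∣face∣+excess-1 {d} {F} ((σ₀ , (F₀ , F₀-face@(_ , f₀ , f₀∈T , _) , σ₀≡) , dimσ₀≡d) , maximal) F-face =
    trans (ℤₚ.≤-antisym d≤ ≤d) (cong (λ t → + t - 1ℤ) (sym (∣face∣+excess≡∣facet∣ F-face f₀∈T)))
    where
    facet₀ : Subset (n * m)
    facet₀ = faceOf E (graph f₀)
    ∣σ₀∣≤∣facet₀∣ : ∣ σ₀ ∣ ≤ ∣ facet₀ ∣
    ∣σ₀∣≤∣facet₀∣ = subst₂ _≤_ (cong ∣_∣ (sym σ₀≡)) (∣face∣+excess≡∣facet∣ F₀-face f₀∈T) (m≤m+n _ _)
    d≤ : d ℤ.≤ dim facet₀
    d≤ = subst (ℤ._≤ dim facet₀) dimσ₀≡d (ℤₚ.+-monoˡ-≤ (ℤ.- 1ℤ) (+≤+ ∣σ₀∣≤∣facet₀∣))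
    ≤d : dim facet₀ ℤ.≤ d
    ≤d = maximal facet₀ (graph-face f₀∈T)

  codim≡excess : ∀ {d F} → IsDim Δ d → IsTFace T E F → codim Δ d (faceOf E F) ≡ + excess F
  codim≡excess {d} {F} isDim F-face = begin
    d - (+ ∣ faceOf E F ∣ - 1ℤ)                                  ≡⟨ cong (_- (+ ∣ faceOf E F ∣ - 1ℤ)) (dim≡∣face∣+excess-1 isDim F-face) ⟩
    (+ (∣ faceOf E F ∣ + excess F) - 1ℤ) - (+ ∣ faceOf E F ∣ - 1ℤ) ≡⟨ cong (λ t → (t - 1ℤ) - (+ ∣ faceOf E F ∣ - 1ℤ)) (pos-+ ∣ faceOf E F ∣ (excess F)) ⟩
    (+ ∣ faceOf E F ∣ ℤ.+ + excess F - 1ℤ) - (+ ∣ faceOf E F ∣ - 1ℤ) ≡⟨ [x+y-1]-[x-1]≡y (+ ∣ faceOf E F ∣) (+ excess F) ⟩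
    + excess F                                                   ∎
    where open ≡-Reasoning

  codim≡sumℤ : ∀ {d F} → IsDim Δ d → IsTFace T E F → codim Δ d (faceOf E F) ≡ sumℤ (λ x → + ∣ F x ∣ - 1ℤ)
  codim≡sumℤ isDim F-face@(_ , _ , _ , f⊆F) =
    trans (codim≡excess isDim F-face) (sym (sumℤ[+a-1]≡+∑[a∸1] _ (⊆ₜ⇒0<∣F∣ f⊆F)))

  codim≡1⇔ : ∀ {d F} → IsDim Δ d → IsTFace T E F →
             codim Δ d (faceOf E F) ≡ 1ℤ ⇔ (∃[ x₀ ] (∣ F x₀ ∣ ≡ 2 × ∀ x → x ≢ x₀ → ∣ F x ∣ ≡ 1))
  codim≡1⇔ {d} {F} isDim F-face@(_ , _ , _ , f⊆F) = mk⇔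
    (to (excess≡1⇔ f⊆F) ∘ +-injective ∘ trans (sym codim≡))
    (trans codim≡ ∘ cong +_ ∘ from (excess≡1⇔ f⊆F))
    where
    codim≡ : codim Δ d (faceOf E F) ≡ + excess F
    codim≡ = codim≡excess isDim F-face

  facet-above-face : ∀ {σ F τ} → σ ≡ faceOf E F → Facet Δ τ → σ ⊆ τ → ∃[ g ] (g ⊆ₜ F × τ ≡ faceOf E (graph g))
  facet-above-face {F = F} σ≡ τ-facet σ⊆τ with facet⇒faceOf-graph τ-facet
  ... | g , g∈T , τ≡ = g , (λ x → graph⊆F x (x∈⁅x⁆ (g x))) , τ≡
    where
    graph⊆F : graph g ⊆ₛ F
    graph⊆F = faceOf-reflects-⊆ E (⊆ₜ⇒graph⊆ₛ (admissible g g∈T)) (subst₂ _⊆_ σ≡ τ≡ σ⊆τ)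

  ridge-in-≤2-facets : ∀ {d} → IsDim Δ d → ∀ ρ → Δ ρ → codim Δ d ρ ≡ 1ℤ →
                       ∀ τ₁ τ₂ τ₃ → Facet Δ τ₁ → Facet Δ τ₂ → Facet Δ τ₃ → ρ ⊆ τ₁ → ρ ⊆ τ₂ → ρ ⊆ τ₃ →
                       τ₁ ≡ τ₂ ⊎ τ₁ ≡ τ₃ ⊎ τ₂ ≡ τ₃
  ridge-in-≤2-facets {d} isDim ρ (F , F-face , ρ≡) codim≡1 τ₁ τ₂ τ₃ τ₁-facet τ₂-facet τ₃-facet ρ⊆τ₁ ρ⊆τ₂ ρ⊆τ₃
    with to (codim≡1⇔ isDim F-face) (subst (λ σ → codim Δ d σ ≡ 1ℤ) ρ≡ codim≡1)
       | facet-above-face {F = F} ρ≡ τ₁-facet ρ⊆τ₁ | facet-above-face {F = F} ρ≡ τ₂-facet ρ⊆τ₂ | facet-above-face {F = F} ρ≡ τ₃-facet ρ⊆τ₃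
  ... | x₀ , ∣Fx₀∣≡2 , ∣F∣≡1 | g₁ , g₁⊆F , τ₁≡ | g₂ , g₂⊆F , τ₂≡ | g₃ , g₃⊆F , τ₃≡ =
    Sum.map (same τ₁≡ τ₂≡) (Sum.map (same τ₁≡ τ₃≡) (same τ₂≡ τ₃≡))
      (⊆ₜ-pigeonhole (λ x x≢x₀ → ≤-reflexive (∣F∣≡1 x x≢x₀)) (≤-reflexive ∣Fx₀∣≡2) g₁⊆F g₂⊆F g₃⊆F)
    where
    same : ∀ {τ τ′ g g′} → τ ≡ faceOf E (graph g) → τ′ ≡ faceOf E (graph g′) → g ≗ g′ → τ ≡ τ′
    same τ≡ τ′≡ g≗g′ = trans τ≡ (trans (faceOf-graph-cong E g≗g′) (sym τ′≡))

  link⇔ : ∀ {F} → F ⊆ₛ E → ∀ D → Link Δ (faceOf E F) D ⇔ TableauComplex n m (filter (_⊆ₜ? F) T) F D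
  link⇔ {F} F⊆E D = mk⇔ toLink fromLink
    where
    encF⊆encE : encode F ⊆ encode E
    encF⊆encE = encode-mono {S = F} {S′ = E} F⊆E
    toLink : Link Δ (faceOf E F) D → TableauComplex n m (filter (_⊆ₜ? F) T) F D
    toLink (D∩C≡∅ , G , (G⊆E , g , g∈T , g⊆G) , D∪C≡) =
      G , (G⊆F , g , ∈-filter⁺ (_⊆ₜ? F) g∈T (λ x → G⊆F x (g⊆G x)) , g⊆G) , trans D≡ (sym (encode-∖ₛ F G))
      where
      split : encode G ⊆ encode F × D ≡ encode F ─ encode G
      split = s∪[p─q]≡p─r⇒s≡q─r encF⊆encE (encode-mono {S = G} {S′ = E} G⊆E)
        (subst (λ c → Empty (D ∩ c)) (faceOf≡─ E {F}) D∩C≡∅)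
        (subst₂ (λ c c′ → D ∪ c ≡ c′) (faceOf≡─ E {F}) (faceOf≡─ E {G}) D∪C≡)
      G⊆F : G ⊆ₛ F
      G⊆F = encode-reflects-⊆ {S = G} {S′ = F} (proj₁ split)
      D≡ : D ≡ encode F ─ encode G
      D≡ = proj₂ split
    fromLink : TableauComplex n m (filter (_⊆ₜ? F) T) F D → Link Δ (faceOf E F) D
    fromLink (G , (G⊆F , g , g∈T′ , g⊆G) , D≡) =
      subst (λ c → Empty (D ∩ c)) (sym (faceOf≡─ E {F})) (proj₁ glued) ,
      G , ((λ x → F⊆E x ∘ G⊆F x) , g , proj₁ (∈-filter⁻ (_⊆ₜ? F) {xs = T} g∈T′) , g⊆G) ,
      subst₂ (λ c c′ → D ∪ c ≡ c′) (sym (faceOf≡─ E {F})) (sym (faceOf≡─ E {G})) (proj₂ glued)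
      where
      glued : Empty (D ∩ (encode E ─ encode F)) × D ∪ (encode E ─ encode F) ≡ encode E ─ encode G
      glued = s≡q─r⇒s∪[p─q]≡p─r encF⊆encE (encode-mono {S = G} {S′ = F} G⊆F) (trans D≡ (encode-∖ₛ F G))

  link≅tableauComplex : ∀ C → Δ C → Σ ℕ λ n′ → Σ ℕ λ m′ → Σ (List (Tableau n′ m′)) λ T′ → Σ (SetTableau n′ m′) λ E′ →
                        Admissible T′ E′ × (Link Δ C ≅ TableauComplex n′ m′ T′ E′)
  link≅tableauComplex C (F , (F⊆E , _) , refl) =
    n , m , filter (_⊆ₜ? F) T , F , (λ f f∈ → proj₂ (∈-filter⁻ (_⊆ₜ? F) {xs = T} f∈)) , ⇔⇒≅ (link⇔ F⊆E)

theorem1p1 : (n m : ℕ) (T : List (Tableau n m)) (E : SetTableau n m) → Admissible T E →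
  -- (1) purity
  Pure (TableauComplex n m T E)
  -- (2) codimension formula and description of ridges
  × (∀ (d : ℤ) → IsDim (TableauComplex n m T E) d → ∀ (F : SetTableau n m) → IsTFace T E F →
       (codim (TableauComplex n m T E) d (faceOf E F) ≡ sumℤ (λ x → + ∣ F x ∣ - 1ℤ))
       × (codim (TableauComplex n m T E) d (faceOf E F) ≡ 1ℤ
           ⇔ (∃[ x₀ ] (∣ F x₀ ∣ ≡ 2 × (∀ x → ¬ x ≡ x₀ → ∣ F x ∣ ≡ 1)))))
  -- (3) each ridge lies in at most two facets
  × (∀ (d : ℤ) → IsDim (TableauComplex n m T E) d → ∀ (ρ : Subset (n * m)) →
       TableauComplex n m T E ρ → codim (TableauComplex n m T E) d ρ ≡ 1ℤ →
       ∀ τ₁ τ₂ τ₃ → Facet (TableauComplex n m T E) τ₁ → Facet (TableauComplex n m T E) τ₂ →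
       Facet (TableauComplex n m T E) τ₃ → ρ ⊆ τ₁ → ρ ⊆ τ₂ → ρ ⊆ τ₃ →
       (τ₁ ≡ τ₂) ⊎ (τ₁ ≡ τ₃) ⊎ (τ₂ ≡ τ₃))
  -- (4) links are isomorphic to tableau complexes
  × (∀ (C : Subset (n * m)) → TableauComplex n m T E C →
       Σ ℕ (λ n′ → Σ ℕ (λ m′ → Σ (List (Tableau n′ m′)) (λ T′ → Σ (SetTableau n′ m′) (λ E′ →
         Admissible T′ E′ × (Link (TableauComplex n m T E) C ≅ TableauComplex n′ m′ T′ E′))))))
theorem1p1 n m T E admissible =
    pure T E admissible
  , (λ _ isDim _ F-face → codim≡sumℤ T E admissible isDim F-face , codim≡1⇔ T E admissible isDim F-face)
  , (λ _ isDim → ridge-in-≤2-facets T E admissible isDim)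
  , link≅tableauComplex T E admissible
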